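{- Let $G$ be a finite simple undirected graph such that every clique in $G^2$ is contained in a set of the form $N_G[v]$ for some vertex $v$ of $G$. Then the inclusion of simplicial complexes $\mathrm{Cl}(G)\hookrightarrow \mathrm{Cl}(G^2)$ is a homotopy equivalence.
   Context: All graphs are simple, finite and undirected. $G^r$ denotes the $r$-th distance power of $G$: the graph on the vertex set $V(G)$ in which two distinct vertices are adjacent iff their distance in $G$ is at most $r$. $N_G[v]=\{v\}\cup\{w: vw\in E(G)\}$ is the closed neighbourhood of $v$. The clique complex $\mathrm{Cl}(G)$ is the simplicial complex with vertex set $V(G)$ whose simplices are the cliques (sets of pairwise adjacent vertices) of $G$. Since $G$ is a subgraph of $G^2$, $\mathrm{Cl}(G)$ is a subcomplex of $\mathrm{Cl}(G^2)$. Simplicial complexes are identified with their geometric realizations. -}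

module Defs where

open import Level using (0ℓ)
open import Data.Empty using (⊥-elim)
open import Data.Fin.Base using (Fin)
open import Data.Fin.Properties using (any?) renaming (_≟_ to _≟ᶠ_)
open import Data.Fin.Subset using (Subset; _∈_; _⊆_; ⁅_⁆)
open import Data.Fin.Subset.Properties using (x∈⁅y⁆⇒x≡y)
open import Data.Nat.Base as ℕ using (ℕ; zero; suc; NonZero)
import Data.Nat.Properties as ℕ
open import Data.Product.Base using (Σ; ∃; _×_; _,_; proj₁; proj₂)
open import Data.Rational.Base as ℚ using (ℚ; 0ℚ; 1ℚ; ½)
import Data.Rational.Properties as ℚ
open import Data.Rational.Solver using (module +-*-Solver)
open import Data.Sum.Base using (_⊎_; inj₁; inj₂; [_,_])
open import Data.Unit.Base using (⊤; tt)
open import Data.Vec.Functional using (foldr)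
open import Function.Base using (_∘_; id)
open import Relation.Binary.Core using (Rel)
open import Relation.Binary.Definitions using (Symmetric; Irreflexive; Decidable)
open import Relation.Binary.PropositionalEquality
  using (_≡_; _≢_; refl; sym; trans; cong; subst; subst₂)
open import Relation.Nullary using (¬_; Dec; yes; no)
open import Relation.Nullary.Decidable using (map′; ¬?; _×-dec_)

------------------------------------------------------------------------
-- Graphs

-- A finite graph on the vertex set Fin n.  Adjacency in a finite graph is
-- decidable; constructively this has to be part of the data.
record Graph (n : ℕ) : Set₁ where
  field
    Adj    : Rel (Fin n) 0ℓ
    sym-A  : Symmetric Adj
    irrefl : Irreflexive _≡_ Adj
    adj?   : Decidable Adj

module _ {n : ℕ} (G : Graph n) where
  open Graph G

  data Walk : Fin n → Fin n → ℕ → Set where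
    []  : ∀ {v} → Walk v v 0
    _∷_ : ∀ {u w v k} → Adj u w → Walk w v k → Walk u v (suc k)

  -- No d satisfies this when u and v lie in different components.
  IsDistance : Fin n → Fin n → ℕ → Set
  IsDistance u v d = Walk u v d × (∀ {k} → Walk u v k → d ℕ.≤ k)

  PowerAdj : ℕ → Rel (Fin n) 0ℓ
  PowerAdj r u v = u ≢ v × ∃ λ d → d ℕ.≤ r × IsDistance u v d

  IsClique : Subset n → Set
  IsClique σ = ∀ {u v} → u ∈ σ → v ∈ σ → u ≢ v → Adj u v

  private
    snoc : ∀ {u w v k} → Walk u w k → Adj w v → Walk u v (suc k)
    snoc []      b = b ∷ []
    snoc (a ∷ p) b = a ∷ snoc p b

    reverse : ∀ {u v k} → Walk u v k → Walk v u k
    reverse []      = []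
    reverse (a ∷ p) = snoc (reverse p) (sym-A a)

    walk? : ∀ u v k → Dec (Walk u v k)
    walk? u v zero    = map′ (λ { refl → [] }) (λ { [] → refl }) (u ≟ᶠ v)
    walk? u v (suc k) = map′ (λ { (_ , a , p) → a ∷ p }) (λ { (a ∷ p) → _ , a , p })
                             (any? λ w → adj? u w ×-dec walk? w v k)

    isDistance? : ∀ u v d → Dec (IsDistance u v d)
    isDistance? u v d =
      map′ to from (walk? u v d ×-dec ℕ.allUpTo? (λ k → ¬? (walk? u v k)) d)
      where
      to : Walk u v d × (∀ {k} → k ℕ.< d → ¬ Walk u v k) → IsDistance u v d
      to (p , shorter) = p , λ q → ℕ.≮⇒≥ λ k<d → shorter k<d q
      from : IsDistance u v d → Walk u v d × (∀ {k} → k ℕ.< d → ¬ Walk u v k)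
      from (p , least) = p , λ k<d q → ℕ.<⇒≱ k<d (least q)

  power-sym : ∀ r → Symmetric (PowerAdj r)
  power-sym r (u≢v , d , d≤r , p , least) =
    u≢v ∘ sym , d , d≤r , reverse p , λ q → least (reverse q)

  power? : ∀ r → Decidable (PowerAdj r)
  power? r u v =
    map′ (λ { (u≢v , d , d<1+r , D) → u≢v , d , ℕ.s≤s⁻¹ d<1+r , D })
         (λ { (u≢v , d , d≤r , D) → u≢v , d , ℕ.s≤s d≤r , D })
         (¬? (u ≟ᶠ v) ×-dec ℕ.anyUpTo? (isDistance? u v) (suc r))

  power-⊇ : ∀ r .{{_ : NonZero r}} {u v} → Adj u v → PowerAdj r u v
  power-⊇ (suc r) a = u≢v , 1 , ℕ.s≤s ℕ.z≤n , a ∷ [] ,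
    λ { [] → ⊥-elim (u≢v refl) ; (_ ∷ _) → ℕ.s≤s ℕ.z≤n }
    where u≢v = λ eq → irrefl eq a

-- The closed neighbourhood of v in G, as a predicate on vertices.
N⟨_⟩[_] : ∀ {n} → Graph n → Fin n → Fin n → Set
N⟨ G ⟩[ v ] w = w ≡ v ⊎ Graph.Adj G v w

infixl 8 _^_

_^_ : ∀ {n} → Graph n → ℕ → Graph n
G ^ r = record
  { Adj    = PowerAdj G r
  ; sym-A  = power-sym G r
  ; irrefl = λ eq (u≢v , _) → u≢v eq
  ; adj?   = power? G r
  }

------------------------------------------------------------------------
-- Simplicial complexes

-- The empty set is allowed to be a simplex; it does not affect the
-- geometric realization.
record SimplicialComplex (n : ℕ) : Set₁ where
  field
    IsSimplex   : Subset n → Set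
    vertex      : ∀ v → IsSimplex ⁅ v ⁆
    down-closed : ∀ {σ τ} → σ ⊆ τ → IsSimplex τ → IsSimplex σ

open SimplicialComplex

_⊑_ : ∀ {n} → SimplicialComplex n → SimplicialComplex n → Set
K ⊑ L = ∀ {σ} → IsSimplex K σ → IsSimplex L σ

Cl : ∀ {n} → Graph n → SimplicialComplex n
Cl G = record
  { IsSimplex   = IsClique G
  ; vertex      = λ v p q u≢w → ⊥-elim (u≢w (trans (x∈⁅y⁆⇒x≡y v p) (sym (x∈⁅y⁆⇒x≡y v q))))
  ; down-closed = λ σ⊆τ c p q → c (σ⊆τ p) (σ⊆τ q)
  }

Cl⊑Cl^ : ∀ {n} (G : Graph n) r .{{_ : NonZero r}} → Cl G ⊑ Cl (G ^ r)
Cl⊑Cl^ G r c p q u≢v = power-⊇ G r (c p q u≢v)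

------------------------------------------------------------------------
-- Real numbers, as Cauchy sequences of rationals with equality _≈_

record ℝ : Set where
  field
    seq    : ℕ → ℚ
    cauchy : ∀ ε → 0ℚ ℚ.< ε →
             ∃ λ N → ∀ m n → N ℕ.≤ m → N ℕ.≤ n → ℚ.∣ seq m ℚ.- seq n ∣ ℚ.< ε

open ℝ

infix 4 _≈_ _≤_ _<_

_≈_ : Rel ℝ 0ℓ
x ≈ y = ∀ ε → 0ℚ ℚ.< ε → ∃ λ N → ∀ n → N ℕ.≤ n → ℚ.∣ seq x n ℚ.- seq y n ∣ ℚ.< ε

_≤_ : Rel ℝ 0ℓ
x ≤ y = ∀ ε → 0ℚ ℚ.< ε → ∃ λ N → ∀ n → N ℕ.≤ n → seq x n ℚ.≤ seq y n ℚ.+ ε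

_<_ : Rel ℝ 0ℓ
x < y = ∃ λ ε → 0ℚ ℚ.< ε × ∃ λ N → ∀ n → N ℕ.≤ n → seq x n ℚ.+ ε ℚ.≤ seq y n

private
  half : ∀ {ε} → 0ℚ ℚ.< ε → 0ℚ ℚ.< ½ ℚ.* ε
  half {ε} 0<ε = ℚ.positive⁻¹ (½ ℚ.* ε) {{ℚ.pos*pos⇒pos ½ ε {{ℚ.positive 0<ε}}}}

  halves : ∀ ε → ½ ℚ.* ε ℚ.+ ½ ℚ.* ε ≡ ε
  halves ε = trans (sym (ℚ.*-distribʳ-+ ε ½ ½)) (ℚ.*-identityˡ ε)

  open +-*-Solver

  +-interchange : ∀ a b c d → (a ℚ.+ b) ℚ.- (c ℚ.+ d) ≡ (a ℚ.- c) ℚ.+ (b ℚ.- d)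
  +-interchange = solve 4 (λ a b c d → (a :+ b) :- (c :+ d) := (a :- c) :+ (b :- d)) refl

  neg-diff : ∀ a b → ℚ.- a ℚ.- ℚ.- b ≡ ℚ.- (a ℚ.- b)
  neg-diff = solve 2 (λ a b → :- a :- :- b := :- (a :- b)) refl

  sub-add : ∀ a b → (a ℚ.- b) ℚ.+ b ≡ a
  sub-add = solve 2 (λ a b → (a :- b) :+ b := a) refl

  add-sub : ∀ a b → (a ℚ.+ b) ℚ.- b ≡ a
  add-sub = solve 2 (λ a b → (a :+ b) :- b := a) refl

  flip-sub : ∀ a b → ℚ.- (a ℚ.- b) ≡ b ℚ.- a
  flip-sub = solve 2 (λ a b → :- (a :- b) := b :- a) refl

  ∣∣-sym : ∀ a b → ℚ.∣ a ℚ.- b ∣ ≡ ℚ.∣ b ℚ.- a ∣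
  ∣∣-sym a b = trans (sym (ℚ.∣-p∣≡∣p∣ (a ℚ.- b))) (cong ℚ.∣_∣ (flip-sub a b))

  ∣∣-diff-≤ : ∀ a b → ℚ.∣ a ∣ ℚ.- ℚ.∣ b ∣ ℚ.≤ ℚ.∣ a ℚ.- b ∣
  ∣∣-diff-≤ a b = begin
    ℚ.∣ a ∣ ℚ.- ℚ.∣ b ∣                           ≡⟨ cong (λ z → ℚ.∣ z ∣ ℚ.- ℚ.∣ b ∣) (sub-add a b) ⟨
    ℚ.∣ (a ℚ.- b) ℚ.+ b ∣ ℚ.- ℚ.∣ b ∣             ≤⟨ ℚ.+-monoˡ-≤ (ℚ.- ℚ.∣ b ∣) (ℚ.∣p+q∣≤∣p∣+∣q∣ (a ℚ.- b) b) ⟩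
    (ℚ.∣ a ℚ.- b ∣ ℚ.+ ℚ.∣ b ∣) ℚ.- ℚ.∣ b ∣       ≡⟨ add-sub ℚ.∣ a ℚ.- b ∣ ℚ.∣ b ∣ ⟩
    ℚ.∣ a ℚ.- b ∣                                 ∎
    where open ℚ.≤-Reasoning

  ∣∣-lipschitz : ∀ a b → ℚ.∣ ℚ.∣ a ∣ ℚ.- ℚ.∣ b ∣ ∣ ℚ.≤ ℚ.∣ a ℚ.- b ∣
  ∣∣-lipschitz a b with ℚ.∣p∣≡p∨∣p∣≡-p (ℚ.∣ a ∣ ℚ.- ℚ.∣ b ∣)
  ... | inj₁ eq = subst (ℚ._≤ ℚ.∣ a ℚ.- b ∣) (sym eq) (∣∣-diff-≤ a b)
  ... | inj₂ eq = subst₂ ℚ._≤_ (sym (trans eq (flip-sub ℚ.∣ a ∣ ℚ.∣ b ∣))) (∣∣-sym b a) (∣∣-diff-≤ b a)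

fromℚ : ℚ → ℝ
fromℚ q = record
  { seq    = λ _ → q
  ; cauchy = λ ε 0<ε → 0 , λ _ _ _ _ → subst (λ z → ℚ.∣ z ∣ ℚ.< ε) (sym (ℚ.+-inverseʳ q)) 0<ε
  }

0ℝ 1ℝ : ℝ
0ℝ = fromℚ 0ℚ
1ℝ = fromℚ 1ℚ

infixl 6 _+_ _-_
infix  8 -_

_+_ : ℝ → ℝ → ℝ
x + y = record
  { seq    = λ n → seq x n ℚ.+ seq y n
  ; cauchy = λ ε 0<ε →
      let M , p = cauchy x (½ ℚ.* ε) (half 0<ε)
          N , q = cauchy y (½ ℚ.* ε) (half 0<ε)
      in M ℕ.⊔ N , λ m n M⊔N≤m M⊔N≤n → begin-strict
        ℚ.∣ (seq x m ℚ.+ seq y m) ℚ.- (seq x n ℚ.+ seq y n) ∣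
          ≡⟨ cong ℚ.∣_∣ (+-interchange (seq x m) (seq y m) (seq x n) (seq y n)) ⟩
        ℚ.∣ (seq x m ℚ.- seq x n) ℚ.+ (seq y m ℚ.- seq y n) ∣
          ≤⟨ ℚ.∣p+q∣≤∣p∣+∣q∣ (seq x m ℚ.- seq x n) (seq y m ℚ.- seq y n) ⟩
        ℚ.∣ seq x m ℚ.- seq x n ∣ ℚ.+ ℚ.∣ seq y m ℚ.- seq y n ∣
          <⟨ ℚ.+-mono-< (p m n (ℕ.m⊔n≤o⇒m≤o M N M⊔N≤m) (ℕ.m⊔n≤o⇒m≤o M N M⊔N≤n))
                        (q m n (ℕ.m⊔n≤o⇒n≤o M N M⊔N≤m) (ℕ.m⊔n≤o⇒n≤o M N M⊔N≤n)) ⟩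
        ½ ℚ.* ε ℚ.+ ½ ℚ.* ε
          ≡⟨ halves ε ⟩
        ε ∎
  }
  where open ℚ.≤-Reasoning

-_ : ℝ → ℝ
- x = record
  { seq    = λ n → ℚ.- seq x n
  ; cauchy = λ ε 0<ε → let N , p = cauchy x ε 0<ε in
      N , λ m n N≤m N≤n →
        subst (ℚ._< ε)
          (sym (trans (cong ℚ.∣_∣ (neg-diff (seq x m) (seq x n)))
                      (ℚ.∣-p∣≡∣p∣ (seq x m ℚ.- seq x n))))
          (p m n N≤m N≤n)
  }

_-_ : ℝ → ℝ → ℝ
x - y = x + - y

∣_∣ : ℝ → ℝ
∣ x ∣ = record
  { seq    = λ n → ℚ.∣ seq x n ∣
  ; cauchy = λ ε 0<ε → let N , p = cauchy x ε 0<ε in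
      N , λ m n N≤m N≤n → ℚ.≤-<-trans (∣∣-lipschitz (seq x m) (seq x n)) (p m n N≤m N≤n)
  }

∑ : ∀ {n} → (Fin n → ℝ) → ℝ
∑ = foldr _+_ 0ℝ

------------------------------------------------------------------------
-- Spaces and homotopies

-- A subset of ℝ^Coord with the topology of the max-metric.  Coord is a
-- finite set (Fin n, a singleton, or a disjoint union of such) in every use.
record Space : Set₁ where
  field
    Coord  : Set
    Member : (Coord → ℝ) → Set

  Point : Set
  Point = Σ (Coord → ℝ) Member

open Space using (Coord; Member; Point)

-- The max-distance of x and y is less than δ.
Within : ∀ (X : Space) → ℝ → Rel (Point X) 0ℓ
Within X δ (x , _) (y , _) = ∀ (i : Coord X) → ∣ x i - y i ∣ < δ

SamePoint : ∀ (X : Space) → Rel (Point X) 0ℓ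
SamePoint X (x , _) (y , _) = ∀ (i : Coord X) → x i ≈ y i

-- Continuity forces a map to send equal points to equal points, so no
-- separate congruence condition is needed in _⟶_.
Continuous : ∀ (X Y : Space) → (Point X → Point Y) → Set
Continuous X Y f = ∀ x ε → 0ℝ < ε → ∃ λ δ → 0ℝ < δ ×
                   (∀ y → Within X δ x y → Within Y ε (f x) (f y))

infix 3 _⟶_

record _⟶_ (X Y : Space) : Set where
  field
    to         : Point X → Point Y
    continuous : Continuous X Y to

open _⟶_

idᶜ : ∀ {X} → X ⟶ X
idᶜ = record { to = id ; continuous = λ x ε 0<ε → ε , 0<ε , λ y → id }

infixr 9 _∘ᶜ_

_∘ᶜ_ : ∀ {X Y Z} → Y ⟶ Z → X ⟶ Y → X ⟶ Z
g ∘ᶜ f = record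
  { to         = to g ∘ to f
  ; continuous = λ x ε 0<ε →
      let η , 0<η , p = continuous g (to f x) ε 0<ε
          δ , 0<δ , q = continuous f x η 0<η
      in δ , 0<δ , λ y → p (to f y) ∘ q y
  }

infixr 5 _×ˢ_

_×ˢ_ : Space → Space → Space
X ×ˢ Y = record
  { Coord  = Coord X ⊎ Coord Y
  ; Member = λ p → Member X (p ∘ inj₁) × Member Y (p ∘ inj₂)
  }

pair : ∀ {X Y} → Point X → Point Y → Point (X ×ˢ Y)
pair (x , x∈X) (y , y∈Y) = [ x , y ] , x∈X , y∈Y

[0,1] : Space
[0,1] = record
  { Coord  = ⊤
  ; Member = λ t → 0ℝ ≤ t tt × t tt ≤ 1ℝ
  }

private
  const-≤ : ∀ {p q} → p ℚ.≤ q → fromℚ p ≤ fromℚ q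
  const-≤ {p} {q} p≤q ε 0<ε = 0 , λ _ _ →
    subst (ℚ._≤ q ℚ.+ ε) (ℚ.+-identityʳ p) (ℚ.+-mono-≤ p≤q (ℚ.<⇒≤ 0<ε))

start end : Point [0,1]
start = (λ _ → 0ℝ) , const-≤ (ℚ.≤-refl {0ℚ}) , const-≤ (ℚ.nonNegative⁻¹ 1ℚ)
end   = (λ _ → 1ℝ) , const-≤ (ℚ.nonNegative⁻¹ 1ℚ) , const-≤ (ℚ.≤-refl {1ℚ})

Homotopic : ∀ {X Y} → X ⟶ Y → X ⟶ Y → Set
Homotopic {X} {Y} f g = ∃ λ (H : X ×ˢ [0,1] ⟶ Y) →
  (∀ x → SamePoint Y (to H (pair {X} {[0,1]} x start)) (to f x)) ×
  (∀ x → SamePoint Y (to H (pair {X} {[0,1]} x end))   (to g x))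

IsHomotopyEquivalence : ∀ {X Y} → X ⟶ Y → Set
IsHomotopyEquivalence {X} {Y} f = ∃ λ (g : Y ⟶ X) →
  Homotopic (g ∘ᶜ f) idᶜ × Homotopic (f ∘ᶜ g) idᶜ

------------------------------------------------------------------------
-- Geometric realization

-- Barycentric coordinates whose support is a simplex.  The support of a real
-- vector is not decidable, hence the last clause: every set of vertices with
-- positive coordinates is a simplex.
∥_∥ : ∀ {n} → SimplicialComplex n → Space
∥_∥ {n} K = record
  { Coord  = Fin n
  ; Member = λ x → (∀ v → 0ℝ ≤ x v) × ∑ x ≈ 1ℝ ×
                   (∀ (σ : Subset n) → (∀ {v} → v ∈ σ → 0ℝ < x v) → IsSimplex K σ)
  }

inclusion : ∀ {n} (K L : SimplicialComplex n) → K ⊑ L → ∥ K ∥ ⟶ ∥ L ∥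
inclusion K L K⊑L = record
  { to         = λ { (x , x≥0 , ∑x≈1 , supp) → x , x≥0 , ∑x≈1 , λ σ pos → K⊑L (supp σ pos) }
  ; continuous = λ x ε 0<ε → ε , 0<ε , λ y → id
  }

{-# OPTIONS --safe #-}
module Submission where

-- Write C(σ) for the set of vertices whose closed neighbourhood contains σ.  If
-- σ is a nonempty clique of G², then so is σ ∪ C(σ), so the hypothesis yields
-- a vertex in D(σ) = C(σ) ∩ C(C(σ)).  For σ ⊆ τ we have D(σ) ⊆ C(C(τ)) and
-- D(τ) ⊆ C(τ) ⊆ C(σ), so every element of D(σ) is adjacent or equal to every
-- element of D(τ).  Hence a choice of d(σ) ∈ D(σ) is a simplicial map from the
-- barycentric subdivision of Cl(G²) to Cl(G), and this is the homotopy inverse: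
-- together with σ the chosen vertices of faces of σ form a clique of G² (as
-- C(σ) is nonempty), and a clique of G if σ is one, so both composites are
-- homotopic to the identity.
--
-- In coordinates the map sends x to ∑ᵤ ∫₀^{xᵤ} d({v : x_v > t}) dt.  Instead of the
-- straight-line homotopy, which needs real multiplication, only the
-- mass zᵤ = min(xᵤ, 2(1 − s)) of each vertex is moved at time s.  All these
-- formulas are uniformly continuous on rational vectors, so they extend to real
-- points termwise along the Cauchy sequences.

open import Defs hiding (_+_; _-_; -_; ∣_∣; _<_; _≤_; _≈_)
open import Data.Empty using (⊥-elim)
open import Data.Fin.Base using (Fin; zero; suc)
open import Data.Fin.Properties using (any?; all?) renaming (_≟_ to _≟ᶠ_)
open import Data.Fin.Subset using (Subset; Nonempty; _∈_; _⊆_; inside; outside; ⁅_⁆; _∪_)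
open import Data.Fin.Subset.Properties using (_∈?_; x∈⁅x⁆; x∈⁅y⁆⇒x≡y; x∈p∪q⁺; x∈p∪q⁻)
open import Data.Nat.Base as ℕ using (ℕ; zero; suc)
import Data.Nat.Properties as ℕ
open import Data.Product.Base using (∃; _×_; _,_; proj₁; proj₂)
open import Data.Rational.Base hiding (NonZero)
open import Data.Rational.Properties
open import Data.Rational.Solver using (module +-*-Solver)
open import Data.Sum.Base using (_⊎_; inj₁; inj₂; [_,_]′)
open import Data.Unit.Base using (⊤; tt)
open import Data.Vec.Base using ([]; _∷_; here; there; tabulate)
open import Data.Vec.Properties using (lookup⇒[]=; []=⇒lookup; lookup∘tabulate)
open import Function.Base using (_∘_; id)
open import Level using (0ℓ)
open import Relation.Binary.PropositionalEquality
open import Relation.Nullary using (¬_; Dec; yes; no; does)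
open import Relation.Nullary.Decidable using (_×-dec_; _⊎-dec_; _→-dec_; dec-true)
open import Relation.Unary using (Pred; Decidable)
open import Algebra.Properties.CommutativeMonoid.Sum +-0-commutativeMonoid
  using (sum; sum-cong-≗; ∑-distrib-+; ∑-comm; sum-replicate-zero)

open +-*-Solver using (solve; _:=_; _:+_; _:-_; :-_; con)
open ℝ
open Space
open _⟶_

-- Rational estimates

_∼[_]_ : ℚ → ℚ → ℚ → Set
p ∼[ ε ] q = ∣ p - q ∣ < ε

∼⇒< : ∀ {ε} p q → p ∼[ ε ] q → p < q + ε
∼⇒< {ε} p q p∼q = begin-strict
  p              ≡⟨ solve 2 (λ p q → p := q :+ (p :- q)) refl p q ⟩
  q + (p - q)    ≤⟨ +-monoʳ-≤ q (p≤∣p∣ (p - q)) ⟩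
  q + ∣ p - q ∣  <⟨ +-monoʳ-< q p∼q ⟩
  q + ε          ∎
  where
  open ≤-Reasoning
  p≤∣p∣ : ∀ p → p ≤ ∣ p ∣
  p≤∣p∣ p with ≤-total 0ℚ p
  ... | inj₁ 0≤p = ≤-reflexive (sym (0≤p⇒∣p∣≡p 0≤p))
  ... | inj₂ p≤0 = ≤-trans p≤0 (0≤∣p∣ p)

<⇒∼ : ∀ {ε} p q → p < q + ε → q < p + ε → p ∼[ ε ] q
<⇒∼ {ε} p q p<q+ε q<p+ε with ∣p∣≡p∨∣p∣≡-p (p - q)
... | inj₁ eq = begin-strict
  ∣ p - q ∣   ≡⟨ eq ⟩
  p - q       <⟨ +-monoˡ-< (- q) p<q+ε ⟩
  q + ε - q   ≡⟨ solve 2 (λ q ε → q :+ ε :- q := ε) refl q ε ⟩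
  ε           ∎
  where open ≤-Reasoning
... | inj₂ eq = begin-strict
  ∣ p - q ∣   ≡⟨ eq ⟩
  - (p - q)   ≡⟨ solve 2 (λ p q → :- (p :- q) := q :- p) refl p q ⟩
  q - p       <⟨ +-monoˡ-< (- p) q<p+ε ⟩
  p + ε - p   ≡⟨ solve 2 (λ p ε → p :+ ε :- p := ε) refl p ε ⟩
  ε           ∎
  where open ≤-Reasoning

∼-refl : ∀ {ε} p → 0ℚ < ε → p ∼[ ε ] p
∼-refl {ε} p 0<ε = subst (λ r → ∣ r ∣ < ε) (sym (+-inverseʳ p)) 0<ε

∼-sym : ∀ {ε} p q → p ∼[ ε ] q → q ∼[ ε ] p
∼-sym {ε} p q = subst (_< ε) (trans (sym (∣-p∣≡∣p∣ (p - q)))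
  (cong ∣_∣ (solve 2 (λ p q → :- (p :- q) := q :- p) refl p q)))

halve : ∀ {ε} → 0ℚ < ε → ∃ λ η → 0ℚ < η × η + η ≡ ε
halve {ε} 0<ε = ½ * ε , positive⁻¹ _ {{pos*pos⇒pos ½ ε {{positive 0<ε}}}} ,
  trans (sym (*-distribʳ-+ ε ½ ½)) (*-identityˡ ε)

⊓-pos : ∀ {p q} → 0ℚ < p → 0ℚ < q → 0ℚ < p ⊓ q
⊓-pos {p} {q} 0<p 0<q with ⊓-sel p q
... | inj₁ eq = subst (0ℚ <_) (sym eq) 0<p
... | inj₂ eq = subst (0ℚ <_) (sym eq) 0<q

+-∼ : ∀ {δ η ε} a b a′ b′ → δ + η ≡ ε → a ∼[ δ ] a′ → b ∼[ η ] b′ → (a + b) ∼[ ε ] (a′ + b′)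
+-∼ {δ} {η} {ε} a b a′ b′ δ+η≡ε a∼a′ b∼b′ = begin-strict
  ∣ (a + b) - (a′ + b′) ∣  ≡⟨ cong ∣_∣ (solve 4 (λ a b a′ b′ → (a :+ b) :- (a′ :+ b′) := (a :- a′) :+ (b :- b′)) refl a b a′ b′) ⟩
  ∣ (a - a′) + (b - b′) ∣  ≤⟨ ∣p+q∣≤∣p∣+∣q∣ (a - a′) (b - b′) ⟩
  ∣ a - a′ ∣ + ∣ b - b′ ∣  <⟨ +-mono-< a∼a′ b∼b′ ⟩
  δ + η                    ≡⟨ δ+η≡ε ⟩
  ε                        ∎
  where open ≤-Reasoning

∼-trans : ∀ {δ η ε} p q r → δ + η ≡ ε → p ∼[ δ ] q → q ∼[ η ] r → p ∼[ ε ] r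
∼-trans {ε = ε} p q r δ+η≡ε p∼q q∼r =
  subst (λ s → ∣ s ∣ < ε) (solve 3 (λ p q r → (p :+ q) :- (q :+ r) := p :- r) refl p q r)
    (+-∼ p q q r δ+η≡ε p∼q q∼r)

neg-∼ : ∀ {ε} p q → p ∼[ ε ] q → (- p) ∼[ ε ] (- q)
neg-∼ {ε} p q = subst (_< ε) (trans (sym (∣-p∣≡∣p∣ (p - q)))
  (cong ∣_∣ (solve 2 (λ p q → :- (p :- q) := :- p :- :- q) refl p q)))

⊔-<-+ : ∀ {ε} a b a′ b′ → a < a′ + ε → b < b′ + ε → a ⊔ b < a′ ⊔ b′ + ε
⊔-<-+ {ε} a b a′ b′ a< b< with ⊔-sel a b
... | inj₁ eq = subst (_< _) (sym eq) (<-≤-trans a< (+-monoˡ-≤ ε (p≤p⊔q a′ b′)))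
... | inj₂ eq = subst (_< _) (sym eq) (<-≤-trans b< (+-monoˡ-≤ ε (p≤q⊔p a′ b′)))

⊓-<-+ : ∀ {ε} a b a′ b′ → a < a′ + ε → b < b′ + ε → a ⊓ b < a′ ⊓ b′ + ε
⊓-<-+ {ε} a b a′ b′ a< b< with ⊓-sel a′ b′
... | inj₁ eq = subst (λ r → _ < r + ε) (sym eq) (≤-<-trans (p⊓q≤p a b) a<)
... | inj₂ eq = subst (λ r → _ < r + ε) (sym eq) (≤-<-trans (p⊓q≤q a b) b<)

⊔-∼ : ∀ {ε} a b a′ b′ → a ∼[ ε ] a′ → b ∼[ ε ] b′ → (a ⊔ b) ∼[ ε ] (a′ ⊔ b′)
⊔-∼ a b a′ b′ p q = <⇒∼ _ _
  (⊔-<-+ a b a′ b′ (∼⇒< a a′ p) (∼⇒< b b′ q))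
  (⊔-<-+ a′ b′ a b (∼⇒< a′ a (∼-sym a a′ p)) (∼⇒< b′ b (∼-sym b b′ q)))

⊓-∼ : ∀ {ε} a b a′ b′ → a ∼[ ε ] a′ → b ∼[ ε ] b′ → (a ⊓ b) ∼[ ε ] (a′ ⊓ b′)
⊓-∼ a b a′ b′ p q = <⇒∼ _ _
  (⊓-<-+ a b a′ b′ (∼⇒< a a′ p) (∼⇒< b b′ q))
  (⊓-<-+ a′ b′ a b (∼⇒< a′ a (∼-sym a a′ p)) (∼⇒< b′ b (∼-sym b b′ q)))

-- Uniformly continuous functions of rational vectors

module _ {C : Set} where

  -- The modulus is the same for all rational vectors, so that applying `f` termwise to a family of
  -- Cauchy sequences with a common bound on indices gives a Cauchy sequence again.
  record UniformlyContinuous (f : (C → ℚ) → ℚ) : Set where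
    constructor uc
    field
      modulus : ∀ {ε} → 0ℚ < ε → ∃ λ δ → 0ℚ < δ ×
                (∀ q r → (∀ c → q c ∼[ δ ] r c) → f q ∼[ ε ] f r)

  open UniformlyContinuous public

  uc-coord : ∀ c → UniformlyContinuous (λ q → q c)
  uc-coord c = uc λ {ε} 0<ε → ε , 0<ε , λ q r q∼r → q∼r c

  uc-const : ∀ p → UniformlyContinuous (λ _ → p)
  uc-const p = uc λ {ε} 0<ε → ε , 0<ε , λ _ _ _ → ∼-refl p 0<ε

  module _ {f g : (C → ℚ) → ℚ} (uf : UniformlyContinuous f) (ug : UniformlyContinuous g) where

    common-modulus : ∀ {ε} → 0ℚ < ε → ∃ λ δ → 0ℚ < δ ×
      (∀ q r → (∀ c → q c ∼[ δ ] r c) → f q ∼[ ε ] f r × g q ∼[ ε ] g r)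
    common-modulus 0<ε =
      let δ , 0<δ , p = modulus uf 0<ε
          η , 0<η , p′ = modulus ug 0<ε
      in δ ⊓ η , ⊓-pos 0<δ 0<η , λ q r q∼r →
        p  q r (λ c → <-≤-trans (q∼r c) (p⊓q≤p δ η)) ,
        p′ q r (λ c → <-≤-trans (q∼r c) (p⊓q≤q δ η))

    uc-+ : UniformlyContinuous (λ q → f q + g q)
    uc-+ = uc λ 0<ε →
      let η , 0<η , η+η≡ε = halve 0<ε
          δ , 0<δ , p = common-modulus 0<η
      in δ , 0<δ , λ q r q∼r → let s , t = p q r q∼r in
        +-∼ (f q) (g q) (f r) (g r) η+η≡ε s t

    uc-⊔ : UniformlyContinuous (λ q → f q ⊔ g q)
    uc-⊔ = uc λ 0<ε → let δ , 0<δ , p = common-modulus 0<ε in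
      δ , 0<δ , λ q r q∼r → let s , t = p q r q∼r in
        ⊔-∼ (f q) (g q) (f r) (g r) s t

    uc-⊓ : UniformlyContinuous (λ q → f q ⊓ g q)
    uc-⊓ = uc λ 0<ε → let δ , 0<δ , p = common-modulus 0<ε in
      δ , 0<δ , λ q r q∼r → let s , t = p q r q∼r in
        ⊓-∼ (f q) (g q) (f r) (g r) s t

  uc-neg : ∀ {f} → UniformlyContinuous f → UniformlyContinuous (λ q → - f q)
  uc-neg {f} uf = uc λ 0<ε → let δ , 0<δ , p = modulus uf 0<ε in
    δ , 0<δ , λ q r q∼r → neg-∼ (f q) (f r) (p q r q∼r)

  uc-sum : ∀ {n} {f : Fin n → (C → ℚ) → ℚ} → (∀ i → UniformlyContinuous (f i)) →
           UniformlyContinuous (λ q → sum (λ i → f i q))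
  uc-sum {zero}  uf = uc-const 0ℚ
  uc-sum {suc n} uf = uc-+ (uf zero) (uc-sum (uf ∘ suc))

infix 8 _⁺
-- A Cauchy sequence with nonnegative limit may have negative terms; truncation turns them into
-- masses.
_⁺ : ℚ → ℚ
p ⁺ = p ⊔ 0ℚ

clamp : ℚ → ℚ → ℚ → ℚ
clamp lo hi p = lo ⊔ (hi ⊓ p)

clamp≤hi : ∀ {lo hi} p → lo ≤ hi → clamp lo hi p ≤ hi
clamp≤hi {lo} {hi} p lo≤hi = ⊔-lub lo≤hi (p⊓q≤p hi p)

-- Superlevel sets

-- The measure of the set of those t in the interval from lo to hi for which d
-- maps the superlevel set {v : q v > t} to w.  Above c = clamp lo hi (q zero)
-- the vertex zero has left the superlevel set, below c it belongs to it.
layer : ∀ {n} m → (Subset m → Fin n) → Fin n → (Fin m → ℚ) → ℚ → ℚ → ℚ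
layer zero d w q lo hi with d [] ≟ᶠ w
... | yes _ = hi - lo
... | no  _ = 0ℚ
layer (suc m) d w q lo hi =
  layer m (d ∘ (inside  ∷_)) w (q ∘ suc) lo (clamp lo hi (q zero)) +
  layer m (d ∘ (outside ∷_)) w (q ∘ suc) (clamp lo hi (q zero)) hi

-- The bounds vary with the vector too, because the recursion replaces them by clamps of its
-- coordinates. The test on `d []` does not look at the vector, so it causes no jump.
uc-layer : ∀ {C : Set} {n} m (d : Subset m → Fin n) w {f : Fin m → (C → ℚ) → ℚ} {lo hi} →
  (∀ i → UniformlyContinuous (f i)) → UniformlyContinuous lo → UniformlyContinuous hi →
  UniformlyContinuous (λ q → layer m d w (λ i → f i q) (lo q) (hi q))
uc-layer zero d w uf ulo uhi with d [] ≟ᶠ w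
... | yes _ = uc-+ uhi (uc-neg ulo)
... | no  _ = uc-const 0ℚ
uc-layer (suc m) d w uf ulo uhi =
  uc-+ (uc-layer m _ w (uf ∘ suc) ulo ucl) (uc-layer m _ w (uf ∘ suc) ucl uhi)
  where ucl = uc-⊔ ulo (uc-⊓ uhi (uf zero))

sum-indicator : ∀ {n} (v : Fin n) p (f : Fin n → ℚ) → f v ≡ p → (∀ w → v ≢ w → f w ≡ 0ℚ) → sum f ≡ p
sum-indicator {suc n} zero p f fv f0 = trans (cong₂ _+_ fv
  (trans (sum-cong-≗ (λ w → f0 (suc w) λ ())) (sum-replicate-zero n))) (+-identityʳ p)
sum-indicator (suc v) p f fv f0 = trans (cong₂ _+_ (f0 zero λ ())
  (sum-indicator v p (f ∘ suc) fv (λ w v≢w → f0 (suc w) λ { refl → v≢w refl }))) (+-identityˡ p)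

-- At each leaf of the recursion the whole length goes to the single vertex `d []`, and the lengths
-- telescope.
sum-layer : ∀ {n} m (d : Subset m → Fin n) q lo hi → sum (λ w → layer m d w q lo hi) ≡ hi - lo
sum-layer zero d q lo hi = sum-indicator (d []) _ _ at off
  where
  at : layer 0 d (d []) q lo hi ≡ hi - lo
  at with d [] ≟ᶠ d []
  ... | yes _ = refl
  ... | no ≢ = ⊥-elim (≢ refl)
  off : ∀ w → d [] ≢ w → layer 0 d w q lo hi ≡ 0ℚ
  off w d≢w with d [] ≟ᶠ w
  ... | yes eq = ⊥-elim (d≢w eq)
  ... | no _ = refl
sum-layer (suc m) d q lo hi = begin
  sum (λ w → layer (suc m) d w q lo hi)  ≡⟨ ∑-distrib-+ (λ w → layer m (d ∘ (inside ∷_)) w (q ∘ suc) lo c)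
                                                            (λ w → layer m (d ∘ (outside ∷_)) w (q ∘ suc) c hi) ⟩
  sum (λ w → layer m (d ∘ (inside ∷_)) w (q ∘ suc) lo c) +
  sum (λ w → layer m (d ∘ (outside ∷_)) w (q ∘ suc) c hi)  ≡⟨ cong₂ _+_ (sum-layer m (d ∘ (inside ∷_)) (q ∘ suc) lo c) (sum-layer m (d ∘ (outside ∷_)) (q ∘ suc) c hi) ⟩
  (c - lo) + (hi - c)  ≡⟨ solve 3 (λ lo c hi → (c :- lo) :+ (hi :- c) := hi :- lo) refl lo c hi ⟩
  hi - lo ∎
  where
  open ≡-Reasoning
  c = clamp lo hi (q zero)

0≤q-p : ∀ {p q} → p ≤ q → 0ℚ ≤ q - p
0≤q-p {p} {q} p≤q = subst (_≤ q - p) (+-inverseʳ p) (+-monoˡ-≤ (- p) p≤q)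

layer-nonneg : ∀ {n} m (d : Subset m → Fin n) w q {lo hi} → lo ≤ hi → 0ℚ ≤ layer m d w q lo hi
layer-nonneg zero d w q lo≤hi with d [] ≟ᶠ w
... | yes _ = 0≤q-p lo≤hi
... | no  _ = ≤-refl
layer-nonneg (suc m) d w q {lo} {hi} lo≤hi = +-mono-≤
  (layer-nonneg m _ w _ (p≤p⊔q lo (hi ⊓ q zero)))
  (layer-nonneg m _ w _ (clamp≤hi (q zero) lo≤hi))

-- By absorption every clamp between `lo` and `lo` is `lo`, so all leaves have length 0.
layer-trivial : ∀ {n} m (d : Subset m → Fin n) w q lo → layer m d w q lo lo ≡ 0ℚ
layer-trivial zero d w q lo with d [] ≟ᶠ w
... | yes _ = +-inverseʳ lo
... | no  _ = refl
layer-trivial (suc m) d w q lo rewrite ⊔-absorbs-⊓ lo (q zero) =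
  cong₂ _+_ (layer-trivial m _ w _ lo) (layer-trivial m _ w _ lo)

IsSuperlevel : ∀ {m} → (Fin m → ℚ) → ℚ → Subset m → Set
IsSuperlevel q t S = ∀ v → (v ∈ S → t < q v) × (t < q v → v ∈ S)

positive-summand : ∀ {p q} → 0ℚ < p + q → 0ℚ < p ⊎ 0ℚ < q
positive-summand {p} {q} 0<p+q with 0ℚ <? p | 0ℚ <? q
... | yes 0<p | _       = inj₁ 0<p
... | no _    | yes 0<q = inj₂ 0<q
... | no 0≮p  | no 0≮q  = ⊥-elim (<-irrefl refl (<-≤-trans 0<p+q (+-mono-≤ (≮⇒≥ 0≮p) (≮⇒≥ 0≮q))))

positive-term : ∀ {n} (f : Fin n → ℚ) → 0ℚ < sum f → ∃ λ i → 0ℚ < f i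
positive-term {zero} f 0<0 = ⊥-elim (<-irrefl refl 0<0)
positive-term {suc n} f 0<∑ with positive-summand 0<∑
... | inj₁ 0<f = zero , 0<f
... | inj₂ 0<∑′ = let i , 0<f = positive-term (f ∘ suc) 0<∑′ in suc i , 0<f

-- Positive measure is traced down the recursion to a leaf of positive length, and the path to it
-- spells out `S`. The half-open range of `t` matches the strict inequality in `IsSuperlevel`.
layer-support : ∀ {n} m (d : Subset m → Fin n) w q {lo hi} → 0ℚ < layer m d w q lo hi →
  lo ≤ hi → ∃ λ S → ∃ λ t → lo ≤ t × t < hi × d S ≡ w × IsSuperlevel q t S
layer-support zero d w q {lo} {hi} 0<l lo≤hi with d [] ≟ᶠ w
-- The left end of the leaf interval serves as the level `t`.
... | yes eq = [] , lo , ≤-refl ,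
        subst₂ _<_ (+-identityˡ lo) (solve 2 (λ lo hi → hi :- lo :+ lo := hi) refl lo hi) (+-monoˡ-< lo 0<l) , eq , λ ()
... | no _ = ⊥-elim (<-irrefl refl 0<l)
layer-support (suc m) d w q {lo} {hi} 0<l lo≤hi with positive-summand 0<l
... | inj₁ 0<l′ =
  let S , t , lo≤t , t<c , eq , super = layer-support m _ w _ 0<l′ (p≤p⊔q lo (hi ⊓ q zero))
  in inside ∷ S , t , lo≤t , <-≤-trans t<c (clamp≤hi (q zero) lo≤hi) , eq , λ
    { zero → (λ _ → below lo≤t t<c) , λ _ → here
    ; (suc v) → (λ { (there v∈S) → proj₁ (super v) v∈S }) , λ t<q → there (proj₂ (super v) t<q) }
  where
  below : ∀ {t} → lo ≤ t → t < clamp lo hi (q zero) → t < q zero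
  below {t} lo≤t t<c with ⊔-sel lo (hi ⊓ q zero)
  ... | inj₁ eq = ⊥-elim (<-irrefl refl (≤-<-trans lo≤t (subst (t <_) eq t<c)))
  ... | inj₂ eq = <-≤-trans (subst (t <_) eq t<c) (p⊓q≤q hi (q zero))
... | inj₂ 0<l′ =
  let S , t , c≤t , t<hi , eq , super = layer-support m _ w _ 0<l′ (clamp≤hi (q zero) lo≤hi)
  in outside ∷ S , t , ≤-trans (p≤p⊔q lo (hi ⊓ q zero)) c≤t , t<hi , eq , λ
    { zero → (λ ()) , λ t<q → ⊥-elim (above c≤t t<hi t<q)
    ; (suc v) → (λ { (there v∈S) → proj₁ (super v) v∈S }) , λ t<q → there (proj₂ (super v) t<q) }
  where
  above : ∀ {t} → clamp lo hi (q zero) ≤ t → t < hi → ¬ t < q zero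
  above {t} c≤t t<hi t<q with ⊓-sel hi (q zero)
  ... | inj₁ eq = <-irrefl refl (<-≤-trans t<hi (≤-trans (subst (_≤ clamp lo hi (q zero)) eq (p≤q⊔p lo (hi ⊓ q zero))) c≤t))
  ... | inj₂ eq = <-irrefl refl (<-≤-trans t<q (≤-trans (subst (_≤ clamp lo hi (q zero)) eq (p≤q⊔p lo (hi ⊓ q zero))) c≤t))

-- The superlevel sets of one vector form a chain, as do the faces that span a simplex of the
-- barycentric subdivision.
superlevel-⊆ : ∀ {m} {q : Fin m → ℚ} {s t S T} → s ≤ t → IsSuperlevel q s S → IsSuperlevel q t T →
               ∀ {v} → v ∈ T → v ∈ S
superlevel-⊆ s≤t S-super T-super v∈T = proj₂ (S-super _) (≤-<-trans s≤t (proj₁ (T-super _) v∈T))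

-- Central vertices

comprehension : ∀ {n} {P : Pred (Fin n) 0ℓ} → Decidable P → Subset n
comprehension P? = tabulate (does ∘ P?)

module _ {n} {P : Pred (Fin n) 0ℓ} (P? : Decidable P) where

  ∈-comprehension⁺ : ∀ {v} → P v → v ∈ comprehension P?
  ∈-comprehension⁺ {v} p = lookup⇒[]= v _ (trans (lookup∘tabulate (does ∘ P?) v) (dec-true (P? v) p))

  ∈-comprehension⁻ : ∀ {v} → v ∈ comprehension P? → P v
  ∈-comprehension⁻ {v} v∈ with P? v | trans (sym (lookup∘tabulate (does ∘ P?) v)) ([]=⇒lookup v∈)
  ... | yes p | _ = p
  ... | no _  | ()

module _ {n} (G : Graph n) where
  open Graph G

  N? : ∀ v w → Dec (N⟨ G ⟩[ v ] w)
  N? v w = (w ≟ᶠ v) ⊎-dec adj? v w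

  N-sym : ∀ {v w} → N⟨ G ⟩[ v ] w → N⟨ G ⟩[ w ] v
  N-sym = [ inj₁ ∘ sym , inj₂ ∘ sym-A ]′

  N⇒Adj : ∀ {v w} → N⟨ G ⟩[ v ] w → v ≢ w → Adj v w
  N⇒Adj (inj₁ w≡v) v≢w = ⊥-elim (v≢w (sym w≡v))
  N⇒Adj (inj₂ adj) _   = adj

  -- `PowerAdj` asks for the exact distance, hence the split on adjacency: for distinct nonadjacent
  -- vertices the walk through `c` is shortest.
  N⇒Adj² : ∀ {c v w} → N⟨ G ⟩[ c ] v → N⟨ G ⟩[ c ] w → v ≢ w → Graph.Adj (G ^ 2) v w
  N⇒Adj² {c} {v} {w} c∼v c∼w v≢w with adj? v w
  ... | yes adj = power-⊇ G 2 adj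
  ... | no ¬adj with c∼v | c∼w
  ...   | inj₁ refl | inj₁ refl = ⊥-elim (v≢w refl)
  ...   | inj₁ refl | inj₂ c-w  = ⊥-elim (¬adj c-w)
  ...   | inj₂ c-v  | inj₁ refl = ⊥-elim (¬adj (sym-A c-v))
  ...   | inj₂ c-v  | inj₂ c-w  = v≢w , 2 , ℕ.s≤s (ℕ.s≤s ℕ.z≤n) , sym-A c-v ∷ (c-w ∷ []) , λ
    { []             → ⊥-elim (v≢w refl)
    ; (adj ∷ [])     → ⊥-elim (¬adj adj)
    ; (_ ∷ (_ ∷ _))  → ℕ.s≤s (ℕ.s≤s ℕ.z≤n) }

  -- The sets C(S) and D(S) of the argument at the top, as predicates.
  Common : Subset n → Fin n → Set
  Common S c = ∀ x → x ∈ S → N⟨ G ⟩[ c ] x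

  Central : Subset n → Fin n → Set
  Central S v = Common S v × (∀ c → Common S c → N⟨ G ⟩[ c ] v)

  common? : ∀ S → Decidable (Common S)
  common? S c = all? λ x → (x ∈? S) →-dec N? c x

  central? : ∀ S → Decidable (Central S)
  central? S v = common? S v ×-dec all? λ c → common? S c →-dec N? c v

  -- The default value is never reached on nonempty cliques of G².
  centre : Fin n → Subset n → Fin n
  centre default S with any? (central? S)
  ... | yes (v , _) = v
  ... | no  _       = default

  centre-central : ∀ {default S} → ∃ (Central S) → Central S (centre default S)
  centre-central {S = S} ∃v with any? (central? S)
  ... | yes (_ , p) = p
  ... | no ∄v       = ⊥-elim (∄v ∃v)

  central-nested : ∀ {S T v w} → S ⊆ T → Central S v → Central T w → N⟨ G ⟩[ v ] w
  central-nested S⊆T (_ , v-least) (w-common , _) = N-sym (v-least _ λ x x∈S → w-common x (S⊆T x∈S))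

-- Moving mass to central vertices

PositiveClique : ∀ {n} → Graph n → (Fin n → ℚ) → Set
PositiveClique H q = ∀ {u v} → 0ℚ < q u → 0ℚ < q v → u ≢ v → Graph.Adj H u v

<⁺⇒< : ∀ {t p} → 0ℚ ≤ t → t < p ⁺ → t < p
<⁺⇒< {t} {p} 0≤t t<p⁺ with ⊔-sel p 0ℚ
... | inj₁ eq = subst (t <_) eq t<p⁺
... | inj₂ eq = ⊥-elim (<-irrefl refl (≤-<-trans 0≤t (subst (t <_) eq t<p⁺)))

0<q-p⇒p<q : ∀ {p q} → 0ℚ < q - p → p < q
0<q-p⇒p<q {p} {q} 0<q-p = subst₂ _<_ (+-identityˡ p)
  (solve 2 (λ p q → q :- p :+ p := q) refl p q) (+-monoˡ-< p 0<q-p)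

sum-nonneg : ∀ {m} (f : Fin m → ℚ) → (∀ i → 0ℚ ≤ f i) → 0ℚ ≤ sum f
sum-nonneg {zero}  f 0≤f = ≤-refl
sum-nonneg {suc m} f 0≤f = +-mono-≤ (0≤f zero) (sum-nonneg (f ∘ suc) (0≤f ∘ suc))

module _ {n} (G : Graph n) where

  -- Moving the mass z u of each vertex u along d, and leaving the rest in place.
  pushed : (Fin n → ℚ) → (Fin n → ℚ) → Fin n → ℚ
  pushed q z w = sum λ u → layer n (centre G u) w q 0ℚ (z u)

  slide : (Fin n → ℚ) → (Fin n → ℚ) → Fin n → ℚ
  slide q z w = (q w ⁺ - z w) + pushed q z w

  pushed-nonneg : ∀ q {z} → (∀ u → 0ℚ ≤ z u) → ∀ w → 0ℚ ≤ pushed q z w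
  pushed-nonneg q 0≤z w = sum-nonneg _ λ u → layer-nonneg n (centre G u) w q (0≤z u)

  sum-pushed : ∀ q z → sum (pushed q z) ≡ sum z
  sum-pushed q z = trans (∑-comm λ w u → layer n (centre G u) w q 0ℚ (z u))
    (sum-cong-≗ λ u → trans (sum-layer n (centre G u) q 0ℚ (z u)) (+-identityʳ (z u)))

  sum-slide : ∀ q z → sum (slide q z) ≡ sum (λ w → q w ⁺)
  sum-slide q z = begin
    sum (slide q z)                          ≡⟨ ∑-distrib-+ (λ w → q w ⁺ - z w) (pushed q z) ⟩
    sum (λ w → q w ⁺ - z w) + sum (pushed q z) ≡⟨ cong (sum (λ w → q w ⁺ - z w) +_) (sum-pushed q z) ⟩
    sum (λ w → q w ⁺ - z w) + sum z          ≡⟨ ∑-distrib-+ (λ w → q w ⁺ - z w) z ⟨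
    sum (λ w → q w ⁺ - z w + z w)            ≡⟨ sum-cong-≗ (λ w → solve 2 (λ p z → p :- z :+ z := p) refl (q w ⁺) (z w)) ⟩
    sum (λ w → q w ⁺)                        ∎
    where open ≡-Reasoning

module _ {n} (G : Graph n) (covered : ∀ (σ : Subset n) → Nonempty σ → IsClique (G ^ 2) σ →
  ∃ λ (v : Fin n) → ∀ {w} → w ∈ σ → N⟨ G ⟩[ v ] w) where

  ∃-central : ∀ S → Nonempty S → IsClique (G ^ 2) S → ∃ (Central G S)
  ∃-central S (s , s∈S) clique = v , (λ x x∈S → S∪C⊆N[v] (∈-comprehension⁺ S∪C? (inj₁ x∈S))) ,
    λ c c-common → N-sym G (S∪C⊆N[v] (∈-comprehension⁺ S∪C? (inj₂ c-common)))
    where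
    S∪C? : Decidable (λ x → x ∈ S ⊎ Common G S x)
    S∪C? x = (x ∈? S) ⊎-dec common? G S x

    adjacent : ∀ {x y} → x ∈ S ⊎ Common G S x → y ∈ S ⊎ Common G S y → x ≢ y → Graph.Adj (G ^ 2) x y
    adjacent (inj₁ x∈S) (inj₁ y∈S) = clique x∈S y∈S
    adjacent (inj₁ x∈S) (inj₂ y-c) = N⇒Adj² G (y-c _ x∈S) (inj₁ refl)
    adjacent (inj₂ x-c) (inj₁ y∈S) = N⇒Adj² G (inj₁ refl) (x-c _ y∈S)
    -- Both vertices lie in the closed neighbourhood of `s`; this is one use of the nonemptiness of
    -- `S`.
    adjacent (inj₂ x-c) (inj₂ y-c) = N⇒Adj² G (N-sym G (x-c s s∈S)) (N-sym G (y-c s s∈S))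

    cover = covered (comprehension S∪C?) (s , ∈-comprehension⁺ S∪C? (inj₁ s∈S))
      λ x∈ y∈ → adjacent (∈-comprehension⁻ S∪C? x∈) (∈-comprehension⁻ S∪C? y∈)
    v = proj₁ cover
    S∪C⊆N[v] = proj₂ cover

  module _ {q z : Fin n → ℚ} (0≤z : ∀ u → 0ℚ ≤ z u) (z≤q⁺ : ∀ u → z u ≤ q u ⁺) where

    pushed-support : PositiveClique (G ^ 2) q → ∀ {w} → 0ℚ < pushed G q z w →
      ∃ λ S → ∃ λ t → 0ℚ ≤ t × IsSuperlevel q t S × Nonempty S × Central G S w
    pushed-support clique {w} 0<w =
      let u , 0<l = positive-term _ 0<w
          S , t , 0≤t , t<z , eq , super = layer-support n (centre G u) w q 0<l (0≤z u)
          -- The level lies below `z u`, hence below `q u`, so the vertex that gives the mass is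
          -- itself in the superlevel set.
          u∈S = proj₂ (super u) (<⁺⇒< 0≤t (<-≤-trans t<z (z≤q⁺ u)))
          positive = λ {x} x∈S → ≤-<-trans 0≤t (proj₁ (super x) x∈S)
      in S , t , 0≤t , super , (u , u∈S) , subst (Central G S) eq
           (centre-central G (∃-central S (u , u∈S) λ x∈S y∈S → clique (positive x∈S) (positive y∈S)))

    -- Vertices that receive mass are central for superlevel sets. Comparing the two levels nests
    -- these sets, and `central-nested` applies.
    pushed-clique : PositiveClique (G ^ 2) q → PositiveClique G (pushed G q z)
    pushed-clique clique {v} {w} 0<v 0<w v≢w =
      let S , s , _ , S-super , _ , v-central = pushed-support clique {v} 0<v
          T , t , _ , T-super , _ , w-central = pushed-support clique {w} 0<w
      in [ (λ s≤t → N⇒Adj G (N-sym G (central-nested G (superlevel-⊆ s≤t S-super T-super) w-central v-central)) v≢w)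
         , (λ t≤s → N⇒Adj G (central-nested G (superlevel-⊆ t≤s T-super S-super) v-central w-central) v≢w)
         ]′ (≤-total s t)

    slide-support : ∀ w → 0ℚ < slide G q z w → 0ℚ < q w ⊎ 0ℚ < pushed G q z w
    slide-support w 0<w =
      [ (λ 0<q⁺-z → inj₁ (<⁺⇒< ≤-refl (≤-<-trans (0≤z w) (0<q-p⇒p<q {z w} {q w ⁺} 0<q⁺-z)))) , inj₂ ]′
        (positive-summand {q w ⁺ - z w} {pushed G q z w} 0<w)

    -- Common part of the cases `G` and `G ^ 2` of `H`: what depends on `H` is a pair of an old
    -- vertex and one that receives mass, left to `mixed`.
    slide-clique : ∀ H → (∀ {v w} → Graph.Adj G v w → Graph.Adj H v w) →
      (∀ {v w} → 0ℚ < q v → 0ℚ < pushed G q z w → v ≢ w → Graph.Adj H v w) →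
      PositiveClique (G ^ 2) q → PositiveClique H q → PositiveClique H (slide G q z)
    slide-clique H G⊆H mixed clique² clique {v} {w} 0<v 0<w v≢w =
      cases (slide-support v 0<v) (slide-support w 0<w)
      where
      cases : 0ℚ < q v ⊎ 0ℚ < pushed G q z v → 0ℚ < q w ⊎ 0ℚ < pushed G q z w → Graph.Adj H v w
      cases (inj₁ 0<qv) (inj₁ 0<qw) = clique 0<qv 0<qw v≢w
      cases (inj₁ 0<qv) (inj₂ 0<pw) = mixed {v} {w} 0<qv 0<pw v≢w
      cases (inj₂ 0<pv) (inj₁ 0<qw) = Graph.sym-A H (mixed {w} {v} 0<qw 0<pv (v≢w ∘ sym))
      cases (inj₂ 0<pv) (inj₂ 0<pw) = G⊆H (pushed-clique clique² {v} {w} 0<pv 0<pw v≢w)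

    -- Each vertex of a support that is a clique of `G` lies in C(S) for every superlevel set S of
    -- nonnegative level, so the central vertices of S are in its closed neighbourhood.
    slide-clique₁ : PositiveClique G q → PositiveClique G (slide G q z)
    slide-clique₁ clique = slide-clique G id mixed clique² clique
      where
      clique² : PositiveClique (G ^ 2) q
      clique² 0<u 0<v u≢v = power-⊇ G 2 (clique 0<u 0<v u≢v)

      near : ∀ {v x} → 0ℚ < q v → 0ℚ < q x → N⟨ G ⟩[ v ] x
      near {v} {x} 0<qv 0<qx with x ≟ᶠ v
      ... | yes x≡v = inj₁ x≡v
      ... | no  x≢v = inj₂ (clique 0<qv 0<qx (x≢v ∘ sym))

      mixed : ∀ {v w} → 0ℚ < q v → 0ℚ < pushed G q z w → v ≢ w → Graph.Adj G v w
      mixed {v} {w} 0<qv 0<pw =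
        let S , t , 0≤t , super , _ , _ , w-least = pushed-support clique² {w} 0<pw
        in N⇒Adj G (w-least v λ x x∈S → near 0<qv (≤-<-trans 0≤t (proj₁ (super x) x∈S)))

    slide-clique₂ : PositiveClique (G ^ 2) q → PositiveClique (G ^ 2) (slide G q z)
    slide-clique₂ clique = slide-clique (G ^ 2) (power-⊇ G 2) mixed clique clique
      where
      positive? : Decidable (λ v → 0ℚ < q v)
      positive? v = 0ℚ <? q v

      mixed : ∀ {v w} → 0ℚ < q v → 0ℚ < pushed G q z w → v ≢ w → Graph.Adj (G ^ 2) v w
      mixed {v} {w} 0<qv 0<pw =
        let S , t , 0≤t , super , _ , _ , w-least = pushed-support clique {w} 0<pw
            -- A cover `c` of the whole support lies in C(S), so it is near the central vertex `w`
            -- as well as `v`.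
            c , support⊆N[c] = covered (comprehension positive?) (v , ∈-comprehension⁺ positive? 0<qv)
              λ x∈ y∈ → clique (∈-comprehension⁻ positive? x∈) (∈-comprehension⁻ positive? y∈)
            c-common = λ x x∈S → support⊆N[c] (∈-comprehension⁺ positive? (≤-<-trans 0≤t (proj₁ (super x) x∈S)))
        in N⇒Adj² G (support⊆N[c] (∈-comprehension⁺ positive? 0<qv)) (w-least c c-common)

-- Extension to real points

uc-family : ∀ {C : Set} {n} {f : Fin n → (C → ℚ) → ℚ} → (∀ i → UniformlyContinuous (f i)) →
  ∀ {ε} → 0ℚ < ε → ∃ λ δ → 0ℚ < δ × (∀ q r → (∀ c → q c ∼[ δ ] r c) → ∀ i → f i q ∼[ ε ] f i r)
uc-family {n = zero}  uf {ε} 0<ε = ε , 0<ε , λ _ _ _ ()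
uc-family {n = suc n} uf 0<ε =
  let δ , 0<δ , p = modulus (uf zero) 0<ε
      η , 0<η , p′ = uc-family (uf ∘ suc) 0<ε
  in δ ⊓ η , ⊓-pos 0<δ 0<η , λ q r q∼r → λ
    { zero    → p  q r (λ c → <-≤-trans (q∼r c) (p⊓q≤p δ η))
    ; (suc i) → p′ q r (λ c → <-≤-trans (q∼r c) (p⊓q≤q δ η)) i }

-- The form in which finiteness of a coordinate set is used: indices chosen per coordinate have a
-- common upper bound.
Bounded : Set → Set
Bounded C = ∀ (N : C → ℕ) → ∃ λ B → ∀ c → N c ℕ.≤ B

bounded-Fin : ∀ n → Bounded (Fin n)
bounded-Fin zero    N = 0 , λ ()
bounded-Fin (suc n) N = let B , N≤B = bounded-Fin n (N ∘ suc) in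
  N zero ℕ.⊔ B , λ { zero → ℕ.m≤m⊔n (N zero) B ; (suc i) → ℕ.≤-trans (N≤B i) (ℕ.m≤n⊔m (N zero) B) }

bounded-⊎⊤ : ∀ {C} → Bounded C → Bounded (C ⊎ ⊤)
bounded-⊎⊤ bounded N = let B , N≤B = bounded (N ∘ inj₁) in
  N (inj₂ tt) ℕ.⊔ B , λ { (inj₁ c)  → ℕ.≤-trans (N≤B c) (ℕ.m≤n⊔m (N (inj₂ tt)) B)
                        ; (inj₂ tt) → ℕ.m≤m⊔n (N (inj₂ tt)) B }

at : ∀ {C : Set} → (C → ℝ) → ℕ → C → ℚ
at x k c = seq (x c) k

seq-∑ : ∀ {n} (x : Fin n → ℝ) k → seq (∑ x) k ≡ sum (at x k)
seq-∑ {zero}  x k = refl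
seq-∑ {suc n} x k = cong (seq (x zero) k +_) (seq-∑ (x ∘ suc) k)

lift : ∀ {C} → Bounded C → {f : (C → ℚ) → ℚ} → UniformlyContinuous f → (C → ℝ) → ℝ
lift bounded {f} uf x = record
  { seq    = λ k → f (at x k)
  ; cauchy = λ ε 0<ε →
      let δ , 0<δ , p = modulus uf 0<ε
          B , N≤B = bounded (λ c → proj₁ (cauchy (x c) δ 0<δ))
      in B , λ m n B≤m B≤n → p (at x m) (at x n) λ c →
        proj₂ (cauchy (x c) δ 0<δ) m n (ℕ.≤-trans (N≤B c) B≤m) (ℕ.≤-trans (N≤B c) B≤n)
  }

p<p+ε : ∀ {ε} p → 0ℚ < ε → p < p + ε
p<p+ε {ε} p 0<ε = subst (_< p + ε) (+-identityʳ p) (+-monoʳ-< p 0<ε)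

⁺-∼ : ∀ {ε} p → 0ℚ < ε → 0ℚ < p + ε → (p ⁺) ∼[ ε ] p
⁺-∼ {ε} p 0<ε 0<p+ε = <⇒∼ (p ⁺) p (⊔-lub-< (p<p+ε p 0<ε) 0<p+ε) (≤-<-trans (p≤p⊔q p 0ℚ) (p<p+ε (p ⁺) 0<ε))
  where
  ⊔-lub-< : ∀ {a b c} → a < c → b < c → a ⊔ b < c
  ⊔-lub-< {a} {b} a<c b<c = [ (λ eq → subst (_< _) (sym eq) a<c) , (λ eq → subst (_< _) (sym eq) b<c) ]′ (⊔-sel a b)

-- A nonnegative real has late terms above any given negative rational, so truncation changes them
-- little. Halving `ε` makes the bound strict.
eventually-⁺-∼ : ∀ {x} → 0ℝ Defs.≤ x → ∀ {ε} → 0ℚ < ε →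
  ∃ λ N → ∀ k → N ℕ.≤ k → (seq x k ⁺) ∼[ ε ] seq x k
eventually-⁺-∼ {x} 0≤x {ε} 0<ε =
  let η , 0<η , η+η≡ε = halve 0<ε
      N , p = 0≤x η 0<η
  in N , λ k N≤k → ⁺-∼ (seq x k) 0<ε
       (≤-<-trans (p k N≤k) (+-monoʳ-< (seq x k) (subst (η <_) η+η≡ε (p<p+ε η 0<η))))

-- Shows that images have total mass 1, and later bounds the single coordinates at the start of the
-- homotopy.
eventually-sum⁺-∼ : ∀ {n} (K : SimplicialComplex n) {x} → Member ∥ K ∥ x → ∀ {ε} → 0ℚ < ε →
  ∃ λ N → ∀ k → N ℕ.≤ k → sum (λ v → at x k v ⁺) ∼[ ε ] 1ℚ
eventually-sum⁺-∼ {n} K {x} (0≤x , ∑x≈1 , _) 0<ε =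
  let η , 0<η , η+η≡ε = halve 0<ε
      δ , 0<δ , p = modulus (uc-sum (uc-coord {Fin n})) 0<η
      M , ∑∼1 = ∑x≈1 η 0<η
      B , N≤B = bounded-Fin n (λ v → proj₁ (eventually-⁺-∼ {x v} (0≤x v) 0<δ))
  in M ℕ.⊔ B , λ k M⊔B≤k → ∼-trans (sum (λ v → at x k v ⁺)) (sum (at x k)) 1ℚ η+η≡ε
       (p (λ v → at x k v ⁺) (at x k) λ v → proj₂ (eventually-⁺-∼ {x v} (0≤x v) 0<δ) k
         (ℕ.≤-trans (N≤B v) (ℕ.m⊔n≤o⇒n≤o M B M⊔B≤k)))
       (subst (_∼[ η ] 1ℚ) (seq-∑ x k) (∑∼1 k (ℕ.m⊔n≤o⇒m≤o M B M⊔B≤k)))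

-- The support clause is applied to the two-element set; for a clique complex such pairs carry all
-- the information.
positive-pair : ∀ {n} (H : Graph n) {x} → Member ∥ Cl H ∥ x →
  ∀ {u v} → 0ℝ Defs.< x u → 0ℝ Defs.< x v → u ≢ v → Graph.Adj H u v
positive-pair H {x} (_ , _ , support) {u} {v} 0<xu 0<xv =
  support (⁅ u ⁆ ∪ ⁅ v ⁆)
    (λ w∈ → [ (λ w∈u → subst (λ a → 0ℝ Defs.< x a) (sym (x∈⁅y⁆⇒x≡y u w∈u)) 0<xu)
            , (λ w∈v → subst (λ a → 0ℝ Defs.< x a) (sym (x∈⁅y⁆⇒x≡y v w∈v)) 0<xv) ]′
            (x∈p∪q⁻ ⁅ u ⁆ ⁅ v ⁆ w∈))
    (x∈p∪q⁺ (inj₁ (x∈⁅x⁆ u))) (x∈p∪q⁺ (inj₂ (x∈⁅x⁆ v)))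

-- The barycentric coordinates of a point of X are those indexed by ι.
record RationalMap {n} (X : Space) (bounded : Bounded (Coord X)) (ι : Fin n → Coord X) (H : Graph n)
                   (barycentric : ∀ {x} → Member X x → Member ∥ Cl H ∥ (x ∘ ι)) (J : Graph n) : Set where
  field
    apply      : (Coord X → ℚ) → Fin n → ℚ
    uniform    : ∀ w → UniformlyContinuous (λ q → apply q w)
    nonneg     : ∀ q w → 0ℚ ≤ apply q w
    sum-apply  : ∀ q → sum (apply q) ≡ sum (λ v → q (ι v) ⁺)
    clique     : ∀ q → PositiveClique H (q ∘ ι) → PositiveClique J (apply q)

module _ {n} {X : Space} {bounded : Bounded (Coord X)} {ι : Fin n → Coord X} {H : Graph n}
         {barycentric : ∀ {x} → Member X x → Member ∥ Cl H ∥ (x ∘ ι)} {J : Graph n}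
         (F : RationalMap X bounded ι H barycentric J) where
  open RationalMap F

  value : (Coord X → ℝ) → Fin n → ℝ
  value x w = lift bounded (uniform w) x

  -- Both positive values are inspected at one late index `k`, which reduces the claim to `clique`
  -- for a single rational vector.
  value-clique : ∀ {x} → Member X x → ∀ {u v} → 0ℝ Defs.< value x u → 0ℝ Defs.< value x v →
                 u ≢ v → Graph.Adj J u v
  value-clique {x} x∈X {u} {v} (εᵘ , 0<εᵘ , Nᵘ , pᵘ) (εᵛ , 0<εᵛ , Nᵛ , pᵛ) =
    clique q̂ (λ 0<q̂a 0<q̂b → positive-pair H (barycentric x∈X) (x-positive (ι _) 0<q̂a) (x-positive (ι _) 0<q̂b))
      (keep u (≤-trans (p⊓q≤p εᵘ εᵛ) (subst (_≤ apply q u) (+-identityˡ εᵘ) (pᵘ k (ℕ.m≤m⊔n Nᵘ (Nᵛ ℕ.⊔ B))))))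
      (keep v (≤-trans (p⊓q≤q εᵘ εᵛ) (subst (_≤ apply q v) (+-identityˡ εᵛ) (pᵛ k
        (ℕ.≤-trans (ℕ.m≤m⊔n Nᵛ B) (ℕ.m≤n⊔m Nᵘ (Nᵛ ℕ.⊔ B)))))))
    where
    ε = εᵘ ⊓ εᵛ
    family = uc-family uniform (⊓-pos 0<εᵘ 0<εᵛ)
    δ = proj₁ family
    half-δ = halve (proj₁ (proj₂ family))
    η = proj₁ half-δ
    0<η = proj₁ (proj₂ half-δ)
    -- Of the two halves of `η`, one absorbs the oscillation of the sequences after `k`; the other
    -- remains as the rational witness of positivity.
    half-η = halve 0<η
    θ = proj₁ half-η
    0<θ = proj₁ (proj₂ half-η)
    modulus-of = λ c → cauchy (x c) θ 0<θ
    bound = bounded (λ c → proj₁ (modulus-of c))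
    B = proj₁ bound
    k = Nᵘ ℕ.⊔ (Nᵛ ℕ.⊔ B)
    B≤k = ℕ.≤-trans (ℕ.m≤n⊔m Nᵛ B) (ℕ.m≤n⊔m Nᵘ (Nᵛ ℕ.⊔ B))

    -- Lowering all coordinates by η keeps the values at u and v positive, while a
    -- coordinate that is still positive is bounded away from 0 along the sequence.
    q q̂ : Coord X → ℚ
    q = at x k
    q̂ c = q c - η

    q∼q̂ : ∀ c → q c ∼[ δ ] q̂ c
    q∼q̂ c = subst (λ r → ∣ r ∣ < δ) (solve 2 (λ p e → e := p :- (p :- e)) refl (q c) η)
      (subst (_< δ) (sym (0≤p⇒∣p∣≡p (<⇒≤ 0<η))) (subst (η <_) (proj₂ (proj₂ half-δ)) (p<p+ε η 0<η)))

    keep : ∀ w → ε ≤ apply q w → 0ℚ < apply q̂ w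
    keep w ε≤ = subst₂ _<_ (+-inverseʳ ε) (solve 2 (λ p e → p :+ e :- e := p) refl (apply q̂ w) ε)
      (+-monoˡ-< (- ε) (≤-<-trans ε≤ (∼⇒< (apply q w) (apply q̂ w) (proj₂ (proj₂ family) q q̂ q∼q̂ w))))

    x-positive : ∀ c → 0ℚ < q̂ c → 0ℝ Defs.< x c
    x-positive c 0<q̂c = θ , 0<θ , k , λ m k≤m → <⇒≤ (subst₂ _<_
      (trans (cong (_- θ) (sym (proj₂ (proj₂ half-η)))) (solve 1 (λ t → t :+ t :- t := con 0ℚ :+ t) refl θ))
      (solve 2 (λ p t → p :+ t :- t := p) refl (at x m c) θ)
      (+-monoˡ-< (- θ) (<-trans (0<q-p⇒p<q {η} {q c} 0<q̂c)
        (∼⇒< (q c) (at x m c) (proj₂ (modulus-of c) k m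
          (ℕ.≤-trans (proj₂ bound c) B≤k) (ℕ.≤-trans (proj₂ bound c) (ℕ.≤-trans B≤k k≤m)))))))

  realize : X ⟶ ∥ Cl J ∥
  realize = record
    { to = λ { (x , x∈X) → value x
             , (λ w ε 0<ε → 0 , λ k _ → ≤-trans (nonneg (at x k) w) (<⇒≤ (p<p+ε (apply (at x k) w) 0<ε)))
             , (λ ε 0<ε → let N , p = eventually-sum⁺-∼ (Cl H) (barycentric x∈X) 0<ε in
                 N , λ k N≤k → subst (_∼[ ε ] 1ℚ)
                   (sym (trans (seq-∑ (value x) k) (sum-apply (at x k)))) (p k N≤k))
             , λ σ 0<σ u∈σ v∈σ → value-clique x∈X (0<σ u∈σ) (0<σ v∈σ) }
    ; continuous = λ { (x , _) ε (e , 0<e , N , e≤ε) →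
        -- A strict inequality of reals asks for a rational gap: one half of `e` bounds the
        -- difference, the other is the gap.
        let η , 0<η , η+η≡e = halve 0<e
            δ , 0<δ , p = uc-family uniform 0<η
        in fromℚ δ , (δ , 0<δ , 0 , λ _ _ → ≤-reflexive (+-identityˡ δ)) , λ { (y , _) near w →
          let B , M≤B = bounded (λ c → proj₁ (proj₂ (proj₂ (near c)))) in
          η , 0<η , N ℕ.⊔ B , λ k N⊔B≤k → begin
            ∣ apply (at x k) w - apply (at y k) w ∣ + η
              ≤⟨ +-monoˡ-≤ η (<⇒≤ (p (at x k) (at y k) (λ c →
                   let e′ , 0<e′ , M , ∣x-y∣+e′≤δ = near c in
                   <-≤-trans (p<p+ε ∣ at x k c - at y k c ∣ 0<e′)
                     (∣x-y∣+e′≤δ k (ℕ.≤-trans (M≤B c) (ℕ.m⊔n≤o⇒n≤o N B N⊔B≤k)))) w)) ⟩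
            η + η       ≡⟨ η+η≡e ⟩
            e           ≡⟨ +-identityˡ e ⟨
            0ℚ + e      ≤⟨ e≤ε k (ℕ.m⊔n≤o⇒m≤o N B N⊔B≤k) ⟩
            seq ε k     ∎ } }
    }
    where open ≤-Reasoning

-- The homotopies

module _ {n} (G : Graph n) where

  slide-full : ∀ q {z} → (∀ u → z u ≡ q u ⁺) → ∀ w → slide G q z w ≡ pushed G q (λ u → q u ⁺) w
  slide-full q {z} z≡q⁺ w = trans (cong₂ _+_
    (trans (cong (q w ⁺ -_) (z≡q⁺ w)) (+-inverseʳ (q w ⁺)))
    (sum-cong-≗ λ u → cong (layer n (centre G u) w q 0ℚ) (z≡q⁺ u)))
    (+-identityˡ (pushed G q (λ u → q u ⁺) w))

  slide-none : ∀ q {z} → (∀ u → z u ≡ 0ℚ) → ∀ w → slide G q z w ≡ q w ⁺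
  slide-none q {z} z≡0 w = trans (cong₂ _+_
    (trans (cong (q w ⁺ -_) (z≡0 w)) (+-identityʳ (q w ⁺)))
    (trans (sum-cong-≗ λ u → trans (cong (layer n (centre G u) w q 0ℚ) (z≡0 u)) (layer-trivial n (centre G u) w q 0ℚ))
           (sum-replicate-zero n)))
    (+-identityʳ (q w ⁺))

  module _ {C : Set} {f z : Fin n → (C → ℚ) → ℚ}
           (uf : ∀ u → UniformlyContinuous (f u)) (uz : ∀ u → UniformlyContinuous (z u)) where

    uc-pushed : ∀ w → UniformlyContinuous (λ q → pushed G (λ u → f u q) (λ u → z u q) w)
    uc-pushed w = uc-sum λ u → uc-layer n (centre G u) w uf (uc-const 0ℚ) (uz u)

    uc-slide : ∀ w → UniformlyContinuous (λ q → slide G (λ u → f u q) (λ u → z u q) w)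
    uc-slide w = uc-+ (uc-+ (uc-⊔ (uf w) (uc-const 0ℚ)) (uc-neg (uz w))) (uc-pushed w)

term≤sum : ∀ {n} (f : Fin n → ℚ) → (∀ i → 0ℚ ≤ f i) → ∀ i → f i ≤ sum f
term≤sum f 0≤f zero = subst (_≤ sum f) (+-identityʳ (f zero)) (+-monoʳ-≤ (f zero) (sum-nonneg (f ∘ suc) (0≤f ∘ suc)))
term≤sum f 0≤f (suc i) = ≤-trans (term≤sum (f ∘ suc) (0≤f ∘ suc) i)
  (subst (_≤ sum f) (+-identityˡ (sum (f ∘ suc))) (+-monoˡ-≤ (sum (f ∘ suc)) (0≤f zero)))

-- The factor 2 makes the cap at time 0 strictly larger than every coordinate, so
-- that at each late enough index of the Cauchy sequences all the mass is moved.
cap : ℚ → ℚ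
cap t = (1ℚ - t) ⁺ + (1ℚ - t) ⁺

module _ {n} (G H : Graph n)
  (clique : ∀ {q z : Fin n → ℚ} → (∀ u → 0ℚ ≤ z u) → (∀ u → z u ≤ q u ⁺) →
            PositiveClique H q → PositiveClique H (slide G q z)) where

  moved : (Fin n ⊎ ⊤ → ℚ) → Fin n → ℚ
  moved q u = q (inj₁ u) ⁺ ⊓ cap (q (inj₂ tt))

  moved-nonneg : ∀ q u → 0ℚ ≤ moved q u
  moved-nonneg q u = ⊓-glb (p≤q⊔p (q (inj₁ u)) 0ℚ) (+-mono-≤ (p≤q⊔p s 0ℚ) (p≤q⊔p s 0ℚ))
    where s = 1ℚ - q (inj₂ tt)

  slide-map : RationalMap (∥ Cl H ∥ ×ˢ [0,1]) (bounded-⊎⊤ (bounded-Fin n)) inj₁ H proj₁ H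
  slide-map = record
    { apply     = λ q → slide G (q ∘ inj₁) (moved q)
    ; uniform   = uc-slide G (uc-coord ∘ inj₁) λ u →
        let us = uc-⊔ (uc-+ (uc-const 1ℚ) (uc-neg (uc-coord (inj₂ tt)))) (uc-const 0ℚ) in
        uc-⊓ (uc-⊔ (uc-coord (inj₁ u)) (uc-const 0ℚ)) (uc-+ us us)
    ; nonneg    = λ q w → +-mono-≤ (0≤q-p (p⊓q≤p (q (inj₁ w) ⁺) _))
                                   (pushed-nonneg G (q ∘ inj₁) (moved-nonneg q) w)
    ; sum-apply = λ q → sum-slide G (q ∘ inj₁) (moved q)
    ; clique    = λ q → clique (moved-nonneg q) (λ u → p⊓q≤p (q (inj₁ u) ⁺) _)
    }

  pushed-homotopic-id : (f : ∥ Cl H ∥ ⟶ ∥ Cl H ∥) →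
    (∀ x w k → seq (proj₁ (to f x) w) k ≡ pushed G (at (proj₁ x) k) (λ u → at (proj₁ x) k u ⁺) w) →
    Homotopic f idᶜ
  pushed-homotopic-id f f≡pushed = realize slide-map ,
    (λ { (x , x∈K) w ε 0<ε →
      -- Tolerance 1 puts the sum of the truncated coordinates, hence each of them, below 1 + 1, the
      -- cap at time 0.
      let N , p = eventually-sum⁺-∼ (Cl H) x∈K {1ℚ} (positive⁻¹ 1ℚ) in
      N , λ k N≤k → subst (λ r → r ∼[ ε ] seq (proj₁ (to f (x , x∈K)) w) k)
        (trans (f≡pushed (x , x∈K) w k) (sym (slide-full G (at x k) (λ u → p≤q⇒p⊓q≡p
          (≤-trans (term≤sum (λ v → at x k v ⁺) (λ v → p≤q⊔p (at x k v) 0ℚ) u)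
            (<⇒≤ (∼⇒< (sum (λ v → at x k v ⁺)) 1ℚ (p k N≤k))))) w)))
        (∼-refl (seq (proj₁ (to f (x , x∈K)) w) k) 0<ε) }) ,
    (λ { (x , 0≤x , _) w ε 0<ε →
      -- At time 1 the cap is 0: nothing is moved, and only the truncation separates the two
      -- sequences.
      let N , p = eventually-⁺-∼ {x w} (0≤x w) 0<ε in
      N , λ k N≤k → subst (_∼[ ε ] seq (x w) k)
        (sym (slide-none G (at x k) (λ u → p≥q⇒p⊓q≡q (p≤q⊔p (at x k u) 0ℚ)) w)) (p k N≤k) })

theorem3p1 : ∀ (n : ℕ) (G : Graph n) →
    (∀ (σ : Subset n) → Nonempty σ → IsClique (G ^ 2) σ →
    ∃ λ (v : Fin n) → ∀ {w} → w ∈ σ → N⟨ G ⟩[ v ] w) →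
    IsHomotopyEquivalence (inclusion (Cl G) (Cl (G ^ 2)) (Cl⊑Cl^ G 2))
theorem3p1 n G covered = push ,
  -- The inclusion keeps all coordinates and `realize` acts termwise, so both composites compute to
  -- `pushed` and `refl` suffices.
  pushed-homotopic-id G G (λ {q} {z} → slide-clique₁ G covered {q} {z}) (push ∘ᶜ i) (λ _ _ _ → refl) ,
  pushed-homotopic-id G (G ^ 2) (λ {q} {z} → slide-clique₂ G covered {q} {z}) (i ∘ᶜ push) (λ _ _ _ → refl)
  where
  0≤⁺ : ∀ (q : Fin n → ℚ) u → 0ℚ ≤ q u ⁺
  0≤⁺ q u = p≤q⊔p (q u) 0ℚ

  push-map : RationalMap ∥ Cl (G ^ 2) ∥ (bounded-Fin n) id (G ^ 2) id G
  push-map = record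
    { apply     = λ q → pushed G q (λ u → q u ⁺)
    ; uniform   = uc-pushed G uc-coord (λ u → uc-⊔ (uc-coord u) (uc-const 0ℚ))
    ; nonneg    = λ q → pushed-nonneg G q (0≤⁺ q)
    ; sum-apply = λ q → sum-pushed G q (λ u → q u ⁺)
    ; clique    = λ q → pushed-clique G covered (0≤⁺ q) (λ u → ≤-refl)
    }

  push = realize push-map
  i = inclusion (Cl G) (Cl (G ^ 2)) (Cl⊑Cl^ G 2)
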